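{- Let $A=(a_{ij})_{1\leq i\leq h,\,1\leq j\leq k}$ be an $h\times k$ matrix with integer entries and let $M=\max_{1\leq i\leq h,\,1\leq j\leq k}|a_{ij}|$. Assume that each two rows of $A$ are linearly independent. Then there exists a non-singular matrix $T\in\mathbb{Z}^{k\times k}$ such that $|c_{11}|,|c_{21}|,\ldots,|c_{h1}|$ are distinct positive integers bounded by $h^4M$, where the $c_{ij}$ are given by $$(c_{ij})_{1\leq i\leq h,\,1\leq j\leq k}=(a_{ij})_{1\leq i\leq h,\,1\leq j\leq k}\,T.$$
   Context: Non-singular means $\det T\neq0$. "Each two rows" refers to any two rows with distinct indices.
   Formalization: When A has only one row (h = 1), that row is additionally assumed to be nonzero; for h = 1 and A = 0 the condition on pairs of rows is vacuous, but c_11 = 0 is never positive, so the statement as written fails there. -}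

module Defs where

open import Data.Fin.Base using (Fin; zero; suc; toℕ; punchIn)
open import Data.Integer.Base using (ℤ; 0ℤ; 1ℤ; -1ℤ; _+_; _*_; _^_; ∣_∣)
open import Data.Integer.Properties using (+-0-commutativeMonoid)
open import Data.Nat.Base as ℕ using (ℕ; zero; suc)
open import Data.Product.Base using (_×_)
open import Data.Vec.Functional using (Vector; foldr)
open import Relation.Binary.PropositionalEquality.Core using (_≡_; _≢_)

open import Algebra.Properties.CommutativeMonoid.Sum +-0-commutativeMonoid
  using (sum-syntax) public

Matrix : ℕ → ℕ → Set
Matrix m n = Fin m → Fin n → ℤ

infixl 7 _·_

_·_ : ∀ {l m n} → Matrix l m → Matrix m n → Matrix l n
_·_ {m = m} A B i j = ∑[ s < m ] (A i s * B s j)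

minor : ∀ {m n} → Fin (suc m) → Fin (suc n) → Matrix (suc m) (suc n) → Matrix m n
minor i j A r s = A (punchIn i r) (punchIn j s)

-- Laplace expansion along the first row.
det : ∀ {n} → Matrix n n → ℤ
det {zero}  A = 1ℤ
det {suc n} A =
  ∑[ j < suc n ] ((-1ℤ ^ toℕ j) * A zero j * det (minor zero j A))

NonSingular : ∀ {n} → Matrix n n → Set
NonSingular A = det A ≢ 0ℤ

-- Coefficients are integers; clearing denominators, this is the same as
-- linear independence over ℚ.
LinearlyIndependent : ∀ {n} → Vector ℤ n → Vector ℤ n → Set
LinearlyIndependent u v =
  ∀ (α β : ℤ) → (∀ j → α * u j + β * v j ≡ 0ℤ) → α ≡ 0ℤ × β ≡ 0ℤ

-- The base value 0 of the folds does not affect the maximum of a nonempty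
-- matrix, as absolute values are nonnegative.
maxAbs : ∀ {m n} → Matrix m n → ℕ
maxAbs A = foldr (λ row x → foldr (λ a y → ∣ a ∣ ℕ.⊔ y) 0 row ℕ.⊔ x) 0 A

{-# OPTIONS --safe #-}

-- The entries c i of the first column must avoid the zeros of the h² linear
-- forms c i and c i ± c i′.  N nonzero integer forms in t have a common
-- non-root with Σⱼ |tⱼ| ≤ N: choose the coordinates from the last to the first,
-- so that each form is decided by its first nonzero coefficient; if m forms are
-- decided at coordinate j, each excludes at most one of the m + 1 candidates
-- tⱼ = 0, …, m.  With N = h² this gives |c i| ≤ h² M ≤ h⁴ M, and any nonzero
-- integer vector is the first column of a non-singular integer matrix.

module Submission where

open import Data.Fin.Base using (Fin; zero)
open import Data.Integer.Base using (ℤ; 0ℤ; ∣_∣)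
open import Data.Nat.Base using (ℕ; suc; _*_; _^_; _≤_; _<_; NonZero)
open import Data.Product.Base using (∃-syntax; ∃₂; _×_)
open import Function.Definitions using (Injective)
open import Relation.Binary.PropositionalEquality.Core using (_≡_; _≢_)
open import Defs

open import Data.Fin.Base using (suc; toℕ; punchIn)
import Data.Fin.Properties as Fin
open import Data.Integer.Base as ℤ using (+_; 1ℤ; -1ℤ; -_)
import Data.Integer.Properties as ℤ
open import Data.Integer.Tactic.RingSolver using (solve-∀)
open import Data.List.Base as List using (List; []; _∷_; length; filter; allFin; cartesianProductWith)
open import Data.List.Membership.Propositional using (_∈_)
open import Data.List.Membership.Propositional.Properties
  using (∈-map⁺; ∈-map⁻; ∈-filter⁺; ∈-filter⁻; ∈-cartesianProductWith⁺;
    ∈-cartesianProductWith⁻; ∈-allFin; ∈-lookup)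
open import Data.List.Properties using (length-++; length-map; length-tabulate)
open import Data.List.Relation.Unary.Any using (index)
open import Data.List.Relation.Unary.Any.Properties using (lookup-index)
open import Data.Nat.Base as ℕ using (zero; s≤s⁻¹; z≤n)
import Data.Nat.Properties as ℕ
open import Data.Product.Base using (∃; _,_; proj₁; proj₂)
open import Data.Sum.Base as Sum using (_⊎_; inj₁; inj₂)
open import Data.Vec.Functional using (Vector; foldr; tail; removeAt)
open import Function.Base using (_∘_)
open import Level using (Level)
open import Relation.Binary.PropositionalEquality
  using (refl; sym; trans; cong; cong₂; subst; module ≡-Reasoning)
open import Relation.Nullary using (¬_; yes; no; contradiction; ¬?)
open import Relation.Nullary.Decidable using (decidable-stable)
open import Relation.Unary using (Pred; Decidable)
open import Relation.Unary.Properties using (∁?)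

open import Algebra.Properties.AbelianGroup ℤ.+-0-abelianGroup using (∙-cancelʳ)
open import Algebra.Properties.Semiring.Sum ℤ.+-*-semiring
  using (sum; sum-cong-≗; sum-replicate-zero; sum-remove; ∑-distrib-+; *-distribˡ-sum)

private
  variable
    a p : Level
    A : Set a
    h m n : ℕ

sum-zero : (v : Vector ℤ n) → (∀ j → v j ≡ 0ℤ) → sum v ≡ 0ℤ
sum-zero {n} v v≡0 = trans (sum-cong-≗ v≡0) (sum-replicate-zero n)

Nonzero : Vector ℤ n → Set
Nonzero v = ¬ (∀ j → v j ≡ 0ℤ)

infix 8 _∙_

_∙_ : Vector ℤ n → Vector ℤ n → ℤ
u ∙ t = sum (λ j → u j ℤ.* t j)

‖_‖ : Vector ℤ n → ℕ
‖ t ‖ = foldr (λ x s → ∣ x ∣ ℕ.+ s) 0 t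

∙-linear : ∀ α β (u v t : Vector ℤ n) →
  (λ j → α ℤ.* u j ℤ.+ β ℤ.* v j) ∙ t ≡ α ℤ.* u ∙ t ℤ.+ β ℤ.* v ∙ t
∙-linear α β u v t = begin
  (λ j → α ℤ.* u j ℤ.+ β ℤ.* v j) ∙ t
    ≡⟨ sum-cong-≗ (λ j → expand α β (u j) (v j) (t j)) ⟩
  sum (λ j → α ℤ.* (u j ℤ.* t j) ℤ.+ β ℤ.* (v j ℤ.* t j))
    ≡⟨ ∑-distrib-+ (λ j → α ℤ.* (u j ℤ.* t j)) (λ j → β ℤ.* (v j ℤ.* t j)) ⟩
  sum (λ j → α ℤ.* (u j ℤ.* t j)) ℤ.+ sum (λ j → β ℤ.* (v j ℤ.* t j))
    ≡⟨ cong₂ ℤ._+_ (*-distribˡ-sum α (λ j → u j ℤ.* t j)) (*-distribˡ-sum β (λ j → v j ℤ.* t j)) ⟨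
  α ℤ.* u ∙ t ℤ.+ β ℤ.* v ∙ t ∎
  where
  open ≡-Reasoning
  expand : ∀ α β x y z →
    (α ℤ.* x ℤ.+ β ℤ.* y) ℤ.* z ≡ α ℤ.* (x ℤ.* z) ℤ.+ β ℤ.* (y ℤ.* z)
  expand = solve-∀

∙≢0⇒Nonzero : (u t : Vector ℤ n) → u ∙ t ≢ 0ℤ → Nonzero t
∙≢0⇒Nonzero u t ut≢0 t≡0 =
  ut≢0 (sum-zero _ λ j → trans (cong (u j ℤ.*_) (t≡0 j)) (ℤ.*-zeroʳ (u j)))

∣∙∣≤ : ∀ {M} (u t : Vector ℤ n) → (∀ j → ∣ u j ∣ ≤ M) → ∣ u ∙ t ∣ ≤ ‖ t ‖ * M
∣∙∣≤ {zero}      u t u≤M = z≤n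
∣∙∣≤ {suc n} {M} u t u≤M = begin
  ∣ u zero ℤ.* t zero ℤ.+ tail u ∙ tail t ∣
    ≤⟨ ℤ.∣i+j∣≤∣i∣+∣j∣ (u zero ℤ.* t zero) _ ⟩
  ∣ u zero ℤ.* t zero ∣ ℕ.+ ∣ tail u ∙ tail t ∣
    ≤⟨ ℕ.+-mono-≤ head≤ (∣∙∣≤ (tail u) (tail t) (u≤M ∘ suc)) ⟩
  ∣ t zero ∣ * M ℕ.+ ‖ tail t ‖ * M
    ≡⟨ ℕ.*-distribʳ-+ M ∣ t zero ∣ _ ⟨
  ‖ t ‖ * M ∎
  where
  open ℕ.≤-Reasoning
  head≤ : ∣ u zero ℤ.* t zero ∣ ≤ ∣ t zero ∣ * M
  head≤ = begin
    ∣ u zero ℤ.* t zero ∣   ≡⟨ ℤ.abs-* (u zero) (t zero) ⟩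
    ∣ u zero ∣ * ∣ t zero ∣ ≤⟨ ℕ.*-monoˡ-≤ ∣ t zero ∣ (u≤M zero) ⟩
    M * ∣ t zero ∣          ≡⟨ ℕ.*-comm M _ ⟩
    ∣ t zero ∣ * M          ∎

≤-foldr-⊔ : (f : A → ℕ) (v : Vector A n) (i : Fin n) →
  f (v i) ≤ foldr (λ x y → f x ℕ.⊔ y) 0 v
≤-foldr-⊔ f v zero    = ℕ.m≤m⊔n _ _
≤-foldr-⊔ f v (suc i) = ℕ.≤-trans (≤-foldr-⊔ f (tail v) i) (ℕ.m≤n⊔m (f (v zero)) _)

∣entry∣≤maxAbs : (B : Matrix m n) → ∀ i j → ∣ B i j ∣ ≤ maxAbs B
∣entry∣≤maxAbs B i j = ℕ.≤-trans (≤-foldr-⊔ ∣_∣ (B i) j) (≤-foldr-⊔ _ B i)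

common-nonroot : (α β : Vector ℤ m) → (∀ i → α i ≢ 0ℤ) →
  ∃ λ x → x ≤ m × (∀ i → α i ℤ.* + x ℤ.+ β i ≢ 0ℤ)
common-nonroot {m} α β α≢0
  with Fin.any? {n = suc m} (λ x → Fin.all? (λ i → ¬? (α i ℤ.* + toℕ x ℤ.+ β i ℤ.≟ 0ℤ)))
... | yes (x , nonroot) = toℕ x , s≤s⁻¹ (Fin.toℕ<n x) , nonroot
... | no ∄nonroot = contradiction (Fin.pigeonhole (ℕ.n<1+n m) (proj₁ ∘ root)) distinct
  where
  root : (x : Fin (suc m)) → ∃ λ i → α i ℤ.* + toℕ x ℤ.+ β i ≡ 0ℤ
  root x with Fin.¬∀⟶∃¬ m _ (λ i → ¬? (α i ℤ.* + toℕ x ℤ.+ β i ℤ.≟ 0ℤ)) (∄nonroot ∘ (x ,_))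
  ... | i , ¬nonroot = i , decidable-stable (_ ℤ.≟ 0ℤ) ¬nonroot

  distinct : ¬ ∃₂ λ x y → toℕ x < toℕ y × proj₁ (root x) ≡ proj₁ (root y)
  distinct (x , y , x<y , same) = ℕ.<⇒≢ x<y (ℤ.+-injective
    (ℤ.*-cancelˡ-≡ (α i) (+ toℕ x) (+ toℕ y) {{ℤ.≢-nonZero (α≢0 i)}}
      (∙-cancelʳ (β i) _ _ (trans (proj₂ (root x)) (sym root-y)))))
    where
    i = proj₁ (root x)
    root-y : α i ℤ.* + toℕ y ℤ.+ β i ≡ 0ℤ
    root-y = subst (λ i → α i ℤ.* + toℕ y ℤ.+ β i ≡ 0ℤ) (sym same) (proj₂ (root y))

length-filter-∁ : {P : Pred A p} (P? : Decidable P) (xs : List A) →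
  length (filter (∁? P?) xs) ℕ.+ length (filter P? xs) ≡ length xs
length-filter-∁ P? []       = refl
length-filter-∁ P? (x ∷ xs) with P? x
... | yes _ = trans (ℕ.+-suc _ _) (cong suc (length-filter-∁ P? xs))
... | no  _ = cong suc (length-filter-∁ P? xs)

avoid-forms : (fs : List (Vector ℤ n)) → (∀ {f} → f ∈ fs → Nonzero f) →
  ∃ λ t → (∀ {f} → f ∈ fs → f ∙ t ≢ 0ℤ) × ‖ t ‖ ≤ length fs
avoid-forms {zero}  fs fs≢0 = (λ ()) , (λ f∈fs _ → fs≢0 f∈fs λ ()) , z≤n
avoid-forms {suc n} fs fs≢0 = t , avoids , ‖t‖≤
  where
  headZero? : Decidable (λ (f : Vector ℤ (suc n)) → f zero ≡ 0ℤ)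
  headZero? f = f zero ℤ.≟ 0ℤ

  gs  = filter (∁? headZero?) fs
  fs₀ = filter headZero? fs

  tails≢0 : ∀ {f} → f ∈ List.map tail fs₀ → Nonzero f
  tails≢0 f∈ f≡0 with ∈-map⁻ tail f∈
  ... | g , g∈fs₀ , refl with ∈-filter⁻ headZero? {xs = fs} g∈fs₀
  ... | g∈fs , g₀≡0 = fs≢0 g∈fs λ { zero → g₀≡0 ; (suc j) → f≡0 j }

  rest = avoid-forms (List.map tail fs₀) tails≢0
  t′ = proj₁ rest

  head-choice = common-nonroot (λ i → List.lookup gs i zero) (λ i → tail (List.lookup gs i) ∙ t′)
    (λ i → proj₂ (∈-filter⁻ (∁? headZero?) {xs = fs} (∈-lookup i)))
  x = proj₁ head-choice

  t : Vector ℤ (suc n)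
  t zero    = + x
  t (suc j) = t′ j

  avoids : ∀ {f} → f ∈ fs → f ∙ t ≢ 0ℤ
  avoids {f} f∈fs with headZero? f
  ... | yes f₀≡0 = λ ft≡0 → proj₁ (proj₂ rest) (∈-map⁺ tail (∈-filter⁺ headZero? f∈fs f₀≡0))
          (trans (sym (trans (cong (λ c → c ℤ.* + x ℤ.+ tail f ∙ t′) f₀≡0) (ℤ.+-identityˡ _))) ft≡0)
  ... | no  f₀≢0 = subst (λ f → f ∙ t ≢ 0ℤ) (sym (lookup-index f∈gs))
          (proj₂ (proj₂ head-choice) (index f∈gs))
    where f∈gs = ∈-filter⁺ (∁? headZero?) f∈fs f₀≢0

  ‖t‖≤ : ‖ t ‖ ≤ length fs
  ‖t‖≤ = begin
    x ℕ.+ ‖ t′ ‖                               ≤⟨ ℕ.+-mono-≤ (proj₁ (proj₂ head-choice)) (proj₂ (proj₂ rest)) ⟩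
    length gs ℕ.+ length (List.map tail fs₀)   ≡⟨ cong (length gs ℕ.+_) (length-map tail fs₀) ⟩
    length gs ℕ.+ length fs₀                   ≡⟨ length-filter-∁ headZero? fs ⟩
    length fs                                  ∎
    where open ℕ.≤-Reasoning

det-cong : {B C : Matrix n n} → (∀ i j → B i j ≡ C i j) → det B ≡ det C
det-cong {zero}  B≗C = refl
det-cong {suc n} B≗C = sum-cong-≗ λ j →
  cong₂ ℤ._*_ (cong ((-1ℤ ℤ.^ toℕ j) ℤ.*_) (B≗C zero j))
              (det-cong λ r s → B≗C (suc r) (punchIn j s))

nonSingular-expand : (B : Matrix (suc n) (suc n)) (q : Fin (suc n)) →
  B zero q ≢ 0ℤ → (∀ j → B zero (punchIn q j) ≡ 0ℤ) →
  NonSingular (minor zero q B) → NonSingular B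
nonSingular-expand B q Bq≢0 B≡0 minor≢0 det≡0
  with ℤ.i*j≡0⇒i≡0∨j≡0 ((-1ℤ ℤ.^ toℕ q) ℤ.* B zero q) (trans (sym expand) det≡0)
  where
  term : Vector ℤ _
  term j = (-1ℤ ℤ.^ toℕ j) ℤ.* B zero j ℤ.* det (minor zero j B)

  others : ∀ j → removeAt term q j ≡ 0ℤ
  others j = cong (ℤ._* det (minor zero (punchIn q j) B))
    (trans (cong ((-1ℤ ℤ.^ toℕ (punchIn q j)) ℤ.*_) (B≡0 j)) (ℤ.*-zeroʳ (-1ℤ ℤ.^ toℕ (punchIn q j))))

  expand : det B ≡ term q
  expand = trans (sum-remove {i = q} term)
    (trans (cong (λ s → term q ℤ.+ s) (sum-zero _ others)) (ℤ.+-identityʳ _))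
... | inj₂ minor≡0 = minor≢0 minor≡0
... | inj₁ ±Bq≡0 with ℤ.i*j≡0⇒i≡0∨j≡0 (-1ℤ ℤ.^ toℕ q) ±Bq≡0
...   | inj₂ Bq≡0 = Bq≢0 Bq≡0
...   | inj₁ ±1≡0 = contradiction (ℤ.i^n≡0⇒i≡0 -1ℤ (toℕ q) ±1≡0) λ ()

identity : Matrix n n
identity zero    zero    = 1ℤ
identity zero    (suc _) = 0ℤ
identity (suc _) zero    = 0ℤ
identity (suc i) (suc j) = identity i j

identity-nonSingular : ∀ n → NonSingular (identity {n})
identity-nonSingular zero    = λ ()
identity-nonSingular (suc n) =
  nonSingular-expand (identity {suc n}) zero (λ ()) (λ _ → refl) (identity-nonSingular n)

complete-column : (t : Vector ℤ (suc n)) → Nonzero t →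
  ∃[ T ] NonSingular {suc n} T × (∀ i → T i zero ≡ t i)
complete-column {n} t t≢0 with t zero ℤ.≟ 0ℤ
complete-column {n} t t≢0 | no t₀≢0 =
  T , nonSingular-expand T zero t₀≢0 (λ _ → refl) (identity-nonSingular n) , λ _ → refl
  where
  T : Matrix (suc n) (suc n)
  T i       zero    = t i
  T zero    (suc _) = 0ℤ
  T (suc i) (suc j) = identity i j
complete-column {zero}  t t≢0 | yes t₀≡0 = contradiction (λ { zero → t₀≡0 }) t≢0
complete-column {suc n} t t≢0 | yes t₀≡0
  with T′ , T′-nonSingular , T′-column ←
    complete-column (tail t) (λ t′≡0 → t≢0 λ { zero → t₀≡0 ; (suc j) → t′≡0 j }) =
  T , nonSingular-expand T (suc zero) (λ ()) (λ { zero → t₀≡0 ; (suc _) → refl })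
        (T′-nonSingular ∘ trans (det-cong T′≗minor)) , λ _ → refl
  where
  T : Matrix (suc (suc n)) (suc (suc n))
  T i       zero          = t i
  T zero    (suc zero)    = 1ℤ
  T zero    (suc (suc _)) = 0ℤ
  T (suc _) (suc zero)    = 0ℤ
  T (suc i) (suc (suc j)) = T′ i (suc j)

  T′≗minor : ∀ i j → T′ i j ≡ minor zero (suc zero) T i j
  T′≗minor i zero    = T′-column i
  T′≗minor i (suc j) = refl

-- Over ordered pairs (i , i′), the combinations c i + σ i i′ c i′ run through
-- all c i, all sums and all differences (up to sign), each once: h² forms in all.
σ : Fin h → Fin h → ℤ
σ zero    zero    = 0ℤ
σ zero    (suc _) = 1ℤ
σ (suc _) zero    = -1ℤ
σ (suc i) (suc j) = σ i j

σ-diagonal : (i : Fin h) → σ i i ≡ 0ℤ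
σ-diagonal zero    = refl
σ-diagonal (suc i) = σ-diagonal i

∣i∣≡∣j∣⇒i≡±j : ∀ i j → ∣ i ∣ ≡ ∣ j ∣ → i ≡ j ⊎ i ≡ - j
∣i∣≡∣j∣⇒i≡±j (+ _)      (+ _)      refl = inj₁ refl
∣i∣≡∣j∣⇒i≡±j (+ _)      ℤ.-[1+ _ ] refl = inj₂ refl
∣i∣≡∣j∣⇒i≡±j ℤ.-[1+ _ ] (+ _)      refl = inj₂ refl
∣i∣≡∣j∣⇒i≡±j ℤ.-[1+ _ ] ℤ.-[1+ _ ] refl = inj₁ refl

σ-collision : ∀ (i j : Fin h) x y → i ≢ j → ∣ x ∣ ≡ ∣ y ∣ →
  1ℤ ℤ.* x ℤ.+ σ i j ℤ.* y ≡ 0ℤ ⊎ 1ℤ ℤ.* y ℤ.+ σ j i ℤ.* x ≡ 0ℤ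
σ-collision zero    zero    x y i≢j ∣x∣≡∣y∣ = contradiction refl i≢j
σ-collision (suc i) (suc j) x y i≢j ∣x∣≡∣y∣ = σ-collision i j x y (i≢j ∘ cong suc) ∣x∣≡∣y∣
σ-collision (suc i) zero    x y i≢j ∣x∣≡∣y∣ =
  Sum.swap (σ-collision zero (suc i) y x (i≢j ∘ sym) (sym ∣x∣≡∣y∣))
σ-collision zero    (suc _) x y i≢j ∣x∣≡∣y∣ with ∣i∣≡∣j∣⇒i≡±j x y ∣x∣≡∣y∣
... | inj₁ refl = inj₂ (difference x)
  where
  difference : ∀ x → 1ℤ ℤ.* x ℤ.+ -1ℤ ℤ.* x ≡ 0ℤ
  difference = solve-∀
... | inj₂ refl = inj₁ (cancel y)
  where
  cancel : ∀ y → 1ℤ ℤ.* - y ℤ.+ 1ℤ ℤ.* y ≡ 0ℤ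
  cancel = solve-∀

length-cartesianProductWith : {B C : Set a} (f : A → B → C) (xs : List A) (ys : List B) →
  length (cartesianProductWith f xs ys) ≡ length xs * length ys
length-cartesianProductWith f []       ys = refl
length-cartesianProductWith f (x ∷ xs) ys = trans (length-++ (List.map (f x) ys))
  (cong₂ ℕ._+_ (length-map (f x) ys) (length-cartesianProductWith f xs ys))

rows-nonzero : (B : Matrix h n) →
  (∀ i i′ → i ≢ i′ → LinearlyIndependent (B i) (B i′)) →
  (h ≡ 1 → ∃₂ λ i j → B i j ≢ 0ℤ) → ∀ i → Nonzero (B i)
rows-nonzero {suc zero} B indep nontrivial zero Bi≡0 with zero , j , Bij≢0 ← nontrivial refl =
  Bij≢0 (Bi≡0 j)
rows-nonzero {suc (suc h)} B indep nontrivial i Bi≡0 =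
  contradiction (proj₁ (indep i i′ (Fin.punchInᵢ≢i i zero ∘ sym) 1ℤ 0ℤ dependence)) λ ()
  where
  i′ = punchIn i zero
  dependence : ∀ j → 1ℤ ℤ.* B i j ℤ.+ 0ℤ ℤ.* B i′ j ≡ 0ℤ
  dependence j = cong (λ x → 1ℤ ℤ.* x ℤ.+ 0ℤ) (Bi≡0 j)

lemma1 : ∀ (h k : ℕ) .{{_ : NonZero h}} (A : Matrix h (suc k)) →
    (∀ (i i′ : Fin h) → i ≢ i′ → LinearlyIndependent (A i) (A i′)) →
    (h ≡ 1 → ∃₂ λ i j → A i j ≢ 0ℤ) →
    ∃[ T ] NonSingular {suc k} T ×
      Injective _≡_ _≡_ (λ (i : Fin h) → ∣ (A · T) i zero ∣) ×
      (∀ (i : Fin h) → 0 < ∣ (A · T) i zero ∣ × ∣ (A · T) i zero ∣ ≤ h ^ 4 * maxAbs A)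
lemma1 h@(suc _) k A indep nontrivial = T , T-nonSingular , injective , λ i → positive i , bounded i
  where
  form : Fin h → Fin h → Vector ℤ (suc k)
  form i i′ j = 1ℤ ℤ.* A i j ℤ.+ σ i i′ ℤ.* A i′ j

  diagonal : ∀ i x → 1ℤ ℤ.* x ℤ.+ σ i i ℤ.* x ≡ x
  diagonal i x = trans (cong (λ s → 1ℤ ℤ.* x ℤ.+ s ℤ.* x) (σ-diagonal i))
    (trans (ℤ.+-identityʳ _) (ℤ.*-identityˡ x))

  form-nonzero : ∀ i i′ → Nonzero (form i i′)
  form-nonzero i i′ form≡0 with i Fin.≟ i′
  ... | yes refl = rows-nonzero A indep nontrivial i λ j → trans (sym (diagonal i (A i j))) (form≡0 j)
  ... | no i≢i′ = contradiction (proj₁ (indep i i′ i≢i′ 1ℤ (σ i i′) form≡0)) λ ()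

  forms = cartesianProductWith form (allFin h) (allFin h)

  forms-nonzero : ∀ {f} → f ∈ forms → Nonzero f
  forms-nonzero f∈ with i , i′ , _ , _ , refl ← ∈-cartesianProductWith⁻ form (allFin h) (allFin h) f∈ =
    form-nonzero i i′

  solution = avoid-forms forms forms-nonzero
  t = proj₁ solution

  c : Fin h → ℤ
  c i = A i ∙ t

  c-avoids : ∀ i i′ → 1ℤ ℤ.* c i ℤ.+ σ i i′ ℤ.* c i′ ≢ 0ℤ
  c-avoids i i′ = subst (_≢ 0ℤ) (∙-linear 1ℤ (σ i i′) (A i) (A i′) t)
    (proj₁ (proj₂ solution) (∈-cartesianProductWith⁺ form (∈-allFin i) (∈-allFin i′)))

  c≢0 : ∀ i → c i ≢ 0ℤ
  c≢0 i = subst (_≢ 0ℤ) (diagonal i (c i)) (c-avoids i i)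

  completion = complete-column t (∙≢0⇒Nonzero (A zero) t (c≢0 zero))
  T = proj₁ completion
  T-nonSingular = proj₁ (proj₂ completion)

  column : ∀ i → (A · T) i zero ≡ c i
  column i = sum-cong-≗ λ s → cong (A i s ℤ.*_) (proj₂ (proj₂ completion) s)

  injective : Injective _≡_ _≡_ (λ i → ∣ (A · T) i zero ∣)
  injective {i} {i′} eq = decidable-stable (i Fin.≟ i′) λ i≢i′ →
    Sum.[ c-avoids i i′ , c-avoids i′ i ]
      (σ-collision i i′ (c i) (c i′) i≢i′ (trans (cong ∣_∣ (sym (column i))) (trans eq (cong ∣_∣ (column i′)))))

  positive : ∀ i → 0 < ∣ (A · T) i zero ∣
  positive i = ℕ.n≢0⇒n>0 (c≢0 i ∘ trans (sym (column i)) ∘ ℤ.∣i∣≡0⇒i≡0)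

  bounded : ∀ i → ∣ (A · T) i zero ∣ ≤ h ^ 4 * maxAbs A
  bounded i = begin
    ∣ (A · T) i zero ∣        ≡⟨ cong ∣_∣ (column i) ⟩
    ∣ c i ∣                   ≤⟨ ∣∙∣≤ (A i) t (∣entry∣≤maxAbs A i) ⟩
    ‖ t ‖ * maxAbs A          ≤⟨ ℕ.*-monoˡ-≤ (maxAbs A) (proj₂ (proj₂ solution)) ⟩
    length forms * maxAbs A   ≡⟨ cong (_* maxAbs A) length-forms ⟩
    h ^ 2 * maxAbs A          ≤⟨ ℕ.*-monoˡ-≤ (maxAbs A) (ℕ.^-monoʳ-≤ h {2} {4} (ℕ.m≤m+n 2 2)) ⟩
    h ^ 4 * maxAbs A          ∎
    where
    open ℕ.≤-Reasoning
    length-allFin : length (allFin h) ≡ h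
    length-allFin = length-tabulate {n = h} (λ i → i)

    length-forms : length forms ≡ h ^ 2
    length-forms = trans (length-cartesianProductWith form (allFin h) (allFin h))
      (cong₂ _*_ length-allFin (trans length-allFin (sym (ℕ.*-identityʳ h))))
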